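{- Let $\Delta$ be a simplicial complex, and let $P$ be any one of: skeleton-E, skeleton-mid, skeleton-weakly, skeleton-very-weakly, skeleton-clique. Then $\Delta$ is $P$-chordal if and only if every nonempty induced subcomplex of $\Delta$ has a $P$-simplicial vertex.
   Context: Simplicial complexes are finite and not necessarily pure. A vertex labeling of a complex with $n$ vertices is a bijection of its vertices with $[n]$; $\max f$ is the largest label in $f$; the size of a face is its number of vertices. Two faces of the same dimension $k$ are adjacent if their intersection has dimension $k-1$. A nonempty induced subcomplex consists of all faces of $\Delta$ contained in some nonempty vertex set $W$. $\Delta$ is: - skeleton-E-chordal, if it has a labeling such that for every two faces $f\ne g$ with the same size and same maximum, every $h\subseteq f\cup g$ with $|h|=|f|$ is a face of $\Delta$; - skeleton-mid-chordal, if it has a labeling such that for every two faces $f\neq g$ with the same size $\ge 2$ and same maximum, $\Delta$ contains every $2$-element subset $e$ of $(f\cup g)\setminus\{\max f\}$ and, for each such $e$, some face $h_e$ with $|h_e|=|f|$, $e\subseteq h_e\subseteq (f\cup g)\setminus\{\max f\}$; - skeleton-weakly-chordal, if it has a labeling such that for every two faces $f\ne g$ with the same size and same maximum, $\Delta$ contains some face $h\subseteq(f\cup g)\setminus\{\max f\}$ with $|h|=|f|$; - skeleton-very-weakly-chordal, if it has a labeling such that for every two adjacent faces $f\neq g$ with the same size and same maximum, $(f\cup g)\setminus\{\max f\}\in\Delta$; - skeleton-clique-chordal, if it has a labeling such that for every two faces $f\ne g$ with the same size $\ge2$ and same maximum, every $2$-element subset of $f\cup g$ is a face of $\Delta$.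 A vertex $v$ of a complex $\Gamma$ is: - skeleton-E-simplicial, if for any two faces $f\ne g$ of $\Gamma$ of the same size containing $v$, every subset of $f\cup g$ of size $|f|$ is in $\Gamma$; - skeleton-mid-simplicial, if for any two such faces $\Gamma$ contains each $2$-element subset $e$ of $(f\cup g)\setminus\{v\}$ and, for each such $e$, some face $h_e$ with $|h_e|=|f|$ and $e\subseteq h_e\subseteq(f\cup g)\setminus\{v\}$; - skeleton-weakly-simplicial, if for any two such faces $\Gamma$ contains some face $h\subseteq(f\cup g)\setminus\{v\}$ with $|h|=|f|$; - skeleton-very-weakly-simplicial, if for any two adjacent such faces, $(f\cup g)\setminus\{v\}\in\Gamma$; - skeleton-clique-simplicial, if for any two such faces, $\Gamma$ contains all $2$-element subsets of $f\cup g$. -}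

module Defs where

open import Data.Bool.Properties using (T-≡)
open import Data.Fin using (Fin; _≤_)
open import Data.Fin.Subset using (Subset; _∈_; _⊆_; _∩_; _∪_; _-_; ∣_∣; ⁅_⁆)
open import Data.Fin.Subset.Properties using (_⊆?_)
open import Data.Nat as ℕ using (ℕ; suc)
open import Data.Product using (Σ; ∃; _×_; _,_; proj₁)
open import Data.Vec using (tabulate)
open import Data.Vec.Properties using (lookup∘tabulate; lookup⇒[]=; []=⇒lookup)
open import Function.Base using (_∘_)
open import Function.Bundles using (_↔_; _⇔_; mk⇔; Equivalence; Inverse)
open import Relation.Binary.PropositionalEquality using (_≡_; _≢_; sym; trans)
open import Relation.Nullary.Decidable using (⌊_⌋; toWitness; fromWitness; _×-dec_)
open import Relation.Unary using (Pred; Decidable)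
open import Level using (0ℓ)

private
  variable
    n : ℕ

-- A complex on the ground set Fin n. Elements of the ground set need not be
-- vertices, so that an induced subcomplex lives on the same ground set.
-- The void complex (no faces at all) is allowed.
record SimplicialComplex (n : ℕ) : Set₁ where
  field
    Face   : Pred (Subset n) 0ℓ
    face?  : Decidable Face
    closed : ∀ {f g} → f ⊆ g → Face g → Face f

open SimplicialComplex public

vertices : SimplicialComplex n → Subset n
vertices Δ = tabulate (λ v → ⌊ face? Δ ⁅ v ⁆ ⌋)

∈vertices⇔Face : (Δ : SimplicialComplex n) (v : Fin n) →
                 v ∈ vertices Δ ⇔ Face Δ ⁅ v ⁆
∈vertices⇔Face Δ v = mk⇔
  (λ v∈ → toWitness {a? = face? Δ ⁅ v ⁆}
            (Equivalence.from T-≡ (trans (sym lookup-v) ([]=⇒lookup v∈))))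
  (λ face → lookup⇒[]= v (vertices Δ)
              (trans lookup-v
                (Equivalence.to T-≡ (fromWitness {a? = face? Δ ⁅ v ⁆} face))))
  where
  lookup-v = lookup∘tabulate (λ u → ⌊ face? Δ ⁅ u ⁆ ⌋) v

induced : SimplicialComplex n → Subset n → SimplicialComplex n
induced Δ W = record
  { Face   = λ f → Face Δ f × f ⊆ W
  ; face?  = λ f → face? Δ f ×-dec (f ⊆? W)
  ; closed = λ { f⊆g (g∈Δ , g⊆W) → closed Δ f⊆g g∈Δ , g⊆W ∘ f⊆g }
  }

Adjacent : Subset n → Subset n → Set
Adjacent f g = ∣ f ∣ ≡ ∣ g ∣ × suc ∣ f ∩ g ∣ ≡ ∣ f ∣

Vertex : SimplicialComplex n → Set
Vertex {n} Δ = Σ (Fin n) (_∈ vertices Δ)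

Labeling : SimplicialComplex n → Set
Labeling Δ = Vertex Δ ↔ Fin ∣ vertices Δ ∣

vertexOf : (Δ : SimplicialComplex n) → Labeling Δ → Fin ∣ vertices Δ ∣ → Fin n
vertexOf Δ L i = proj₁ (Inverse.from L i)

-- i is the largest label in f; the empty face has none.
IsMax : (Δ : SimplicialComplex n) → Labeling Δ → Subset n → Fin ∣ vertices Δ ∣ → Set
IsMax Δ L f i = vertexOf Δ L i ∈ f × (∀ j → vertexOf Δ L j ∈ f → j ≤ i)

-- The conclusions of the chordality and simpliciality conditions. The vertex m
-- is the one of largest label in f and g for the former, and the simplicial
-- vertex for the latter.
module _ (Δ : SimplicialComplex n) (f g : Subset n) where

  E-Condition : Set
  E-Condition = ∀ h → h ⊆ f ∪ g → ∣ h ∣ ≡ ∣ f ∣ → Face Δ h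

  MidCondition : Fin n → Set
  MidCondition m = ∀ e → ∣ e ∣ ≡ 2 → e ⊆ (f ∪ g) - m →
    Face Δ e ×
    ∃ λ h → Face Δ h × ∣ h ∣ ≡ ∣ f ∣ × e ⊆ h × h ⊆ (f ∪ g) - m

  WeakCondition : Fin n → Set
  WeakCondition m = ∃ λ h → Face Δ h × h ⊆ (f ∪ g) - m × ∣ h ∣ ≡ ∣ f ∣

  VeryWeakCondition : Fin n → Set
  VeryWeakCondition m = Face Δ ((f ∪ g) - m)

  CliqueCondition : Set
  CliqueCondition = ∀ e → ∣ e ∣ ≡ 2 → e ⊆ f ∪ g → Face Δ e

module _ (Δ : SimplicialComplex n) where

  SkeletonEChordal : Set
  SkeletonEChordal = Σ (Labeling Δ) λ L → ∀ f g i →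
    Face Δ f → Face Δ g → f ≢ g → ∣ f ∣ ≡ ∣ g ∣ → IsMax Δ L f i → IsMax Δ L g i →
    E-Condition Δ f g

  SkeletonMidChordal : Set
  SkeletonMidChordal = Σ (Labeling Δ) λ L → ∀ f g i →
    Face Δ f → Face Δ g → f ≢ g → ∣ f ∣ ≡ ∣ g ∣ → 2 ℕ.≤ ∣ f ∣ → IsMax Δ L f i → IsMax Δ L g i →
    MidCondition Δ f g (vertexOf Δ L i)

  SkeletonWeaklyChordal : Set
  SkeletonWeaklyChordal = Σ (Labeling Δ) λ L → ∀ f g i →
    Face Δ f → Face Δ g → f ≢ g → ∣ f ∣ ≡ ∣ g ∣ → IsMax Δ L f i → IsMax Δ L g i →
    WeakCondition Δ f g (vertexOf Δ L i)

  SkeletonVeryWeaklyChordal : Set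
  SkeletonVeryWeaklyChordal = Σ (Labeling Δ) λ L → ∀ f g i →
    Face Δ f → Face Δ g → f ≢ g → ∣ f ∣ ≡ ∣ g ∣ → Adjacent f g → IsMax Δ L f i → IsMax Δ L g i →
    VeryWeakCondition Δ f g (vertexOf Δ L i)

  SkeletonCliqueChordal : Set
  SkeletonCliqueChordal = Σ (Labeling Δ) λ L → ∀ f g i →
    Face Δ f → Face Δ g → f ≢ g → ∣ f ∣ ≡ ∣ g ∣ → 2 ℕ.≤ ∣ f ∣ → IsMax Δ L f i → IsMax Δ L g i →
    CliqueCondition Δ f g

module _ (Γ : SimplicialComplex n) (v : Fin n) where

  SkeletonESimplicial : Set
  SkeletonESimplicial = v ∈ vertices Γ × ∀ f g →
    Face Γ f → Face Γ g → f ≢ g → ∣ f ∣ ≡ ∣ g ∣ → v ∈ f → v ∈ g →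
    E-Condition Γ f g

  SkeletonMidSimplicial : Set
  SkeletonMidSimplicial = v ∈ vertices Γ × ∀ f g →
    Face Γ f → Face Γ g → f ≢ g → ∣ f ∣ ≡ ∣ g ∣ → v ∈ f → v ∈ g →
    MidCondition Γ f g v

  SkeletonWeaklySimplicial : Set
  SkeletonWeaklySimplicial = v ∈ vertices Γ × ∀ f g →
    Face Γ f → Face Γ g → f ≢ g → ∣ f ∣ ≡ ∣ g ∣ → v ∈ f → v ∈ g →
    WeakCondition Γ f g v

  SkeletonVeryWeaklySimplicial : Set
  SkeletonVeryWeaklySimplicial = v ∈ vertices Γ × ∀ f g →
    Face Γ f → Face Γ g → f ≢ g → ∣ f ∣ ≡ ∣ g ∣ → Adjacent f g → v ∈ f → v ∈ g →
    VeryWeakCondition Γ f g v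

  SkeletonCliqueSimplicial : Set
  SkeletonCliqueSimplicial = v ∈ vertices Γ × ∀ f g →
    Face Γ f → Face Γ g → f ≢ g → ∣ f ∣ ≡ ∣ g ∣ → v ∈ f → v ∈ g →
    CliqueCondition Γ f g

data Property : Set where
  skeleton-E skeleton-mid skeleton-weakly skeleton-very-weakly skeleton-clique : Property

Chordal : Property → SimplicialComplex n → Set
Chordal skeleton-E           = SkeletonEChordal
Chordal skeleton-mid         = SkeletonMidChordal
Chordal skeleton-weakly      = SkeletonWeaklyChordal
Chordal skeleton-very-weakly = SkeletonVeryWeaklyChordal
Chordal skeleton-clique      = SkeletonCliqueChordal

Simplicial : Property → SimplicialComplex n → Fin n → Set
Simplicial skeleton-E           = SkeletonESimplicial
Simplicial skeleton-mid         = SkeletonMidSimplicial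
Simplicial skeleton-weakly      = SkeletonWeaklySimplicial
Simplicial skeleton-very-weakly = SkeletonVeryWeaklySimplicial
Simplicial skeleton-clique      = SkeletonCliqueSimplicial

{-# OPTIONS --safe #-}

-- Both directions match labelings with elimination orders. Given a labeling, the
-- vertex of largest label in W is the largest vertex of every face of Δ[W]
-- containing it, so it is simplicial in Δ[W]. Conversely, remove simplicial
-- vertices one at a time, giving the largest free label to each: a vertex v is
-- then simplicial in Δ[W], where W holds the vertices whose label is at most that
-- of v, and W contains every face with maximum v.
module Submission where

open import Defs
open import Data.Nat using (ℕ)
open import Data.Fin.Subset using (Subset; Nonempty; _⊆_)
open import Data.Product using (∃)
open import Function.Bundles using (_⇔_)

open import Data.Fin using (Fin; zero; suc; opposite; _≟_) renaming (_≤_ to _≤ᶠ_)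
open import Data.Fin.Properties using (any?; opposite-prop; opposite-involutive)
open import Data.Fin.Subset using (_∈_; _∉_; _∪_; _-_; ∣_∣; ⁅_⁆; outside; inside)
open import Data.Fin.Subset.Properties
  using ( x∈⁅x⁆; x∈⁅y⁆⇒x≡y; ∣⁅x⁆∣≡1; ∣⊥∣≡0; ⊆-antisym; ⊆-refl; p⊂q⇒∣p∣<∣q∣; p─⊥≡p
        ; p─q⊆p; x∈p∧x≢y⇒x∈p-y; x∈p⇒p-x⊂p; x∈p∪q⁻; _∈?_; nonempty?; Empty-unique)
open import Data.Nat as ℕ using (z≤n; s≤s)
import Data.Nat.Properties as ℕ
open import Data.Product using (Σ; _×_; _,_; proj₁; proj₂)
open import Data.Product.Properties using (Σ-≡,≡→≡)
open import Data.Sum using ([_,_]′)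
open import Data.Vec using (_∷_; here; there)
open import Data.Vec.Properties.WithK using ([]=-irrelevant)
open import Function.Base using (_∘_; id)
open import Function.Bundles using (_⤖_; mk⇔; mk⤖; Equivalence; Inverse)
open import Function.Definitions using (Injective)
open import Function.Properties.Bijection using (⤖⇒↔)
open import Function.Properties.Inverse using (↔-sym)
open import Relation.Binary.PropositionalEquality
  using (_≡_; _≢_; refl; sym; trans; cong; subst; subst₂)
open import Relation.Nullary using (yes; no; contradiction)
open import Relation.Unary using (Pred; Decidable)
open import Level using (0ℓ)

private
  variable
    n k : ℕ
    p q f g W : Subset n
    x m : Fin n

-- Maxima and sizes of finite sets.

greatest : {P : Pred (Fin k) 0ℓ} → Decidable P → ∃ P → ∃ λ i → P i × ∀ j → P j → j ≤ᶠ i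
-- Positions after `zero` are searched first; `zero` is the answer only when none of them satisfies
-- `P`.
greatest {k = ℕ.suc _} P? (i , Pi) with any? (P? ∘ suc)
... | yes ∃Ps with greatest (P? ∘ suc) ∃Ps
...   | i′ , Pi′ , max = suc i′ , Pi′ , λ { zero _ → z≤n ; (suc j) Pj → s≤s (max j Pj) }
greatest P? (zero , P0) | no ∄Ps =
  zero , P0 , λ { zero _ → z≤n ; (suc j) Pj → contradiction (j , Pj) ∄Ps }
greatest P? (suc i , Pi) | no ∄Ps = contradiction (i , Pi) ∄Ps

opposite-anti-≤ : {i j : Fin n} → i ≤ᶠ j → opposite j ≤ᶠ opposite i
opposite-anti-≤ {n} {i} {j} i≤j =
  subst₂ ℕ._≤_ (sym (opposite-prop j)) (sym (opposite-prop i)) (ℕ.∸-monoʳ-≤ n (s≤s i≤j))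

-- Strictness of `p - x ⊂ p` supplies some `y` in `p` missing from `p - x`, and only `x` itself can
-- be missing.
x∉p-x : {p : Subset n} → x ∈ p → x ∉ p - x
x∉p-x {x = x} x∈p x∈p-x with x∈p⇒p-x⊂p x∈p
... | _ , y , y∈p , y∉p-x with y ≟ x
...   | yes refl = y∉p-x x∈p-x
...   | no y≢x   = y∉p-x (x∈p∧x≢y⇒x∈p-y y∈p y≢x)

x∈p⇒∣p∣≡1+∣p-x∣ : {p : Subset n} → x ∈ p → ∣ p ∣ ≡ ℕ.suc ∣ p - x ∣
x∈p⇒∣p∣≡1+∣p-x∣ {p = inside  ∷ p} here        = cong (ℕ.suc ∘ ∣_∣) (sym (p─⊥≡p p))
x∈p⇒∣p∣≡1+∣p-x∣ {p = inside  ∷ p} (there x∈p) = cong ℕ.suc (x∈p⇒∣p∣≡1+∣p-x∣ x∈p)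
x∈p⇒∣p∣≡1+∣p-x∣ {p = outside ∷ p} (there x∈p) = x∈p⇒∣p∣≡1+∣p-x∣ x∈p

∣p∣≡1+k⇒Nonempty : {p : Subset n} → ∣ p ∣ ≡ ℕ.suc k → Nonempty p
∣p∣≡1+k⇒Nonempty {n} {p = p} ∣p∣≡1+k with nonempty? p
... | yes ne = ne
... | no ¬ne with trans (sym ∣p∣≡1+k) (trans (cong ∣_∣ (Empty-unique ¬ne)) (∣⊥∣≡0 n))
...   | ()

p⊆q∧∣q∣≤∣p∣⇒p≡q : {p q : Subset n} → p ⊆ q → ∣ q ∣ ℕ.≤ ∣ p ∣ → p ≡ q
p⊆q∧∣q∣≤∣p∣⇒p≡q {p = p} {q} p⊆q ∣q∣≤∣p∣ = ⊆-antisym p⊆q q⊆p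
  where
  q⊆p : q ⊆ p
  q⊆p {x} x∈q with x ∈? p
  ... | yes x∈p = x∈p
  ... | no  x∉p = contradiction (p⊂q⇒∣p∣<∣q∣ (p⊆q , x , x∈q , x∉p)) (ℕ.≤⇒≯ ∣q∣≤∣p∣)

⁅x⁆⊆ : x ∈ p → ⁅ x ⁆ ⊆ p
⁅x⁆⊆ {p = p} x∈p y∈⁅x⁆ = subst (_∈ p) (sym (x∈⁅y⁆⇒x≡y _ y∈⁅x⁆)) x∈p

∣p∣≤1⇒p≡⁅x⁆ : x ∈ p → ∣ p ∣ ℕ.≤ 1 → p ≡ ⁅ x ⁆
∣p∣≤1⇒p≡⁅x⁆ {x = x} {p = p} x∈p ∣p∣≤1 =
  sym (p⊆q∧∣q∣≤∣p∣⇒p≡q (⁅x⁆⊆ x∈p) (subst (∣ p ∣ ℕ.≤_) (sym (∣⁅x⁆∣≡1 x)) ∣p∣≤1))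

-- With at most one element, both sets would be the singleton of their common element `x`, hence
-- equal.
≢-meeting⇒2≤∣p∣ : p ≢ q → ∣ p ∣ ≡ ∣ q ∣ → x ∈ p → x ∈ q → 2 ℕ.≤ ∣ p ∣
≢-meeting⇒2≤∣p∣ {p = p} p≢q ∣p∣≡∣q∣ x∈p x∈q with 2 ℕ.≤? ∣ p ∣
... | yes 2≤∣p∣ = 2≤∣p∣
... | no  2≰∣p∣ = contradiction
  (trans (∣p∣≤1⇒p≡⁅x⁆ x∈p ∣p∣≤1)
    (sym (∣p∣≤1⇒p≡⁅x⁆ x∈q (subst (ℕ._≤ 1) ∣p∣≡∣q∣ ∣p∣≤1))))
  p≢q
  where ∣p∣≤1 = ℕ.s≤s⁻¹ (ℕ.≰⇒> 2≰∣p∣)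

-- Elimination orders and labelings.

module _ {n : ℕ} where

  -- `Q W v` stands for simpliciality of `v` in the subcomplex induced on `W`. Index `zero` is
  -- eliminated first, and the `W` of `eliminates` contains `order i` together with all that is
  -- eliminated after it.
  record EliminationOrder (Q : Subset n → Fin n → Set) (V : Subset n) (k : ℕ) : Set where
    field
      order      : Fin k → Fin n
      injective  : Injective _≡_ _≡_ order
      order∈     : ∀ i → order i ∈ V
      complete   : ∀ {x} → x ∈ V → ∃ λ i → order i ≡ x
      eliminates : ∀ i → ∃ λ W → Q W (order i) × ∀ j → i ≤ᶠ j → order j ∈ W

  open EliminationOrder

  -- Induction on the size of `V`: the vertex picked from `V` comes first. The hypothesis covers all
  -- nonempty subsets of `V`, so it passes to `V - v`.
  eliminate : {Q : Subset n → Fin n → Set} (V : Subset n) →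
              (∀ W → Nonempty W → W ⊆ V → ∃ λ v → v ∈ W × Q W v) →
              ∣ V ∣ ≡ k → EliminationOrder Q V k
  eliminate {k = ℕ.zero} V _ ∣V∣≡0 = record
    { order      = λ ()
    ; injective  = λ { {()} }
    ; order∈     = λ ()
    ; complete   = λ x∈V → contradiction (trans (sym (x∈p⇒∣p∣≡1+∣p-x∣ x∈V)) ∣V∣≡0) λ ()
    ; eliminates = λ ()
    }
  eliminate {k = ℕ.suc k} {Q} V pick ∣V∣≡1+k
    with pick V (∣p∣≡1+k⇒Nonempty ∣V∣≡1+k) ⊆-refl
  ... | v , v∈V , Qv = record
    { order      = order′
    ; injective  = injective′
    ; order∈     = order′∈
    ; complete   = complete′
    ; eliminates = eliminates′
    }
    where
    V-v⊆V : V - v ⊆ V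
    V-v⊆V = p─q⊆p V ⁅ v ⁆

    rest : EliminationOrder Q (V - v) k
    rest = eliminate (V - v) (λ W ne W⊆ → pick W ne (V-v⊆V ∘ W⊆))
             (ℕ.suc-injective (trans (sym (x∈p⇒∣p∣≡1+∣p-x∣ v∈V)) ∣V∣≡1+k))

    order′ : Fin (ℕ.suc k) → Fin n
    order′ zero    = v
    order′ (suc i) = order rest i

    v≢ : ∀ i → v ≢ order rest i
    v≢ i v≡ = x∉p-x v∈V (subst (_∈ V - v) (sym v≡) (order∈ rest i))

    injective′ : Injective _≡_ _≡_ order′
    injective′ {zero}  {zero}  _  = refl
    injective′ {zero}  {suc j} eq = contradiction eq (v≢ j)
    injective′ {suc i} {zero}  eq = contradiction (sym eq) (v≢ i)
    injective′ {suc i} {suc j} eq = cong suc (injective rest eq)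

    order′∈ : ∀ i → order′ i ∈ V
    order′∈ zero    = v∈V
    order′∈ (suc i) = V-v⊆V (order∈ rest i)

    complete′ : ∀ {x} → x ∈ V → ∃ λ i → order′ i ≡ x
    complete′ {x} x∈V with x ≟ v
    ... | yes refl = zero , refl
    ... | no x≢v with complete rest (x∈p∧x≢y⇒x∈p-y x∈V x≢v)
    ...   | i , eq = suc i , eq

    eliminates′ : ∀ i → ∃ λ W → Q W (order′ i) × ∀ j → i ≤ᶠ j → order′ j ∈ W
    eliminates′ zero    = V , Qv , λ j _ → order′∈ j
    eliminates′ (suc i) with eliminates rest i
    -- The set comes from the order on `V - v`; `suc i ≤ᶠ j` rules out `j = zero`, so `v` need not
    -- lie in it.
    ... | W , Qi , later = W , Qi , λ { (suc j) (s≤s i≤j) → later j i≤j }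

  -- Reversing indices with `opposite` gives the largest label to the vertex eliminated first, so
  -- smaller labels mean later elimination.
  elimination⇒labeling : (Δ : SimplicialComplex n) {Q : Subset n → Fin n → Set} →
    EliminationOrder Q (vertices Δ) ∣ vertices Δ ∣ →
    Σ (Labeling Δ) λ L →
      ∀ i → ∃ λ W → Q W (vertexOf Δ L i) × ∀ j → j ≤ᶠ i → vertexOf Δ L j ∈ W
  -- With the bijection built from labels to vertices and then inverted, `vertexOf Δ L i` computes
  -- to `order E (opposite i)`.
  elimination⇒labeling Δ E = ↔-sym (⤖⇒↔ bij) , λ i →
    let W , Qi , later = eliminates E (opposite i)
    in  W , Qi , λ j j≤i → later (opposite j) (opposite-anti-≤ j≤i)
    where
    vertex : Fin ∣ vertices Δ ∣ → Vertex Δ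
    vertex i = order E (opposite i) , order∈ E (opposite i)

    bij : Fin ∣ vertices Δ ∣ ⤖ Vertex Δ
    bij = mk⤖ {to = vertex}
      ( (λ {i} {j} eq → trans (sym (opposite-involutive i))
          (trans (cong opposite (injective E (cong proj₁ eq))) (opposite-involutive j)))
      , λ { (x , x∈) → let i , eq = complete E x∈ in
            -- A `Vertex` carries a membership proof; such proofs are unique, so comparing the
            -- underlying elements suffices.
            opposite i , λ { refl → Σ-≡,≡→≡
              ( trans (cong (order E) (opposite-involutive i)) eq
              , []=-irrelevant _ _) } })

module _ (Δ : SimplicialComplex n) (L : Labeling Δ) where

  labelOf : x ∈ vertices Δ → ∃ λ i → vertexOf Δ L i ≡ x
  labelOf x∈ = Inverse.to L (_ , x∈) , cong proj₁ (Inverse.strictlyInverseʳ L (_ , x∈))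

  ∃-IsMax : Nonempty W → W ⊆ vertices Δ → ∃ (IsMax Δ L W)
  ∃-IsMax {W = W} (x , x∈W) W⊆ =
    let i , eq = labelOf (W⊆ x∈W)
    in  greatest (λ j → vertexOf Δ L j ∈? W) (i , subst (_∈ W) (sym eq) x∈W)

-- A common form of the five properties.

Conclusion : Property → (Δ : SimplicialComplex n) (f g : Subset n) → Fin n → Set
Conclusion skeleton-E           Δ f g m = E-Condition Δ f g
Conclusion skeleton-mid         Δ f g m = MidCondition Δ f g m
Conclusion skeleton-weakly      Δ f g m = WeakCondition Δ f g m
-- Adjacency becomes a premise of the conclusion, so that one list of hypotheses serves all five
-- properties.
Conclusion skeleton-very-weakly Δ f g m = Adjacent f g → VeryWeakCondition Δ f g m
Conclusion skeleton-clique      Δ f g m = CliqueCondition Δ f g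

ChordalLabeling : Property → (Δ : SimplicialComplex n) → Labeling Δ → Set
ChordalLabeling P Δ L = ∀ f g i →
  Face Δ f → Face Δ g → f ≢ g → ∣ f ∣ ≡ ∣ g ∣ → IsMax Δ L f i → IsMax Δ L g i →
  Conclusion P Δ f g (vertexOf Δ L i)

PairwiseSimplicial : Property → SimplicialComplex n → Fin n → Set
PairwiseSimplicial P Γ v = ∀ f g →
  Face Γ f → Face Γ g → f ≢ g → ∣ f ∣ ≡ ∣ g ∣ → v ∈ f → v ∈ g → Conclusion P Γ f g v

-- The size bound required of mid- and clique-chordality is automatic: distinct
-- faces of equal size that share a vertex have at least two vertices.
chordal⇔ : (P : Property) (Δ : SimplicialComplex n) →
           Chordal P Δ ⇔ Σ (Labeling Δ) (ChordalLabeling P Δ)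
chordal⇔ skeleton-E Δ = mk⇔ id id
chordal⇔ skeleton-mid Δ = mk⇔
  (λ (L , c) → L , λ f g i f∈ g∈ f≢g eq mf mg →
    c f g i f∈ g∈ f≢g eq (≢-meeting⇒2≤∣p∣ f≢g eq (proj₁ mf) (proj₁ mg)) mf mg)
  (λ (L , c) → L , λ f g i f∈ g∈ f≢g eq _ → c f g i f∈ g∈ f≢g eq)
chordal⇔ skeleton-weakly Δ = mk⇔ id id
chordal⇔ skeleton-very-weakly Δ = mk⇔
  (λ (L , c) → L , λ f g i f∈ g∈ f≢g eq mf mg adj → c f g i f∈ g∈ f≢g eq adj mf mg)
  (λ (L , c) → L , λ f g i f∈ g∈ f≢g eq adj mf mg → c f g i f∈ g∈ f≢g eq mf mg adj)
chordal⇔ skeleton-clique Δ = mk⇔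
  (λ (L , c) → L , λ f g i f∈ g∈ f≢g eq mf mg →
    c f g i f∈ g∈ f≢g eq (≢-meeting⇒2≤∣p∣ f≢g eq (proj₁ mf) (proj₁ mg)) mf mg)
  (λ (L , c) → L , λ f g i f∈ g∈ f≢g eq _ → c f g i f∈ g∈ f≢g eq)

simplicial⇔ : (P : Property) (Γ : SimplicialComplex n) (v : Fin n) →
              Simplicial P Γ v ⇔ (v ∈ vertices Γ × PairwiseSimplicial P Γ v)
simplicial⇔ skeleton-E Γ v = mk⇔ id id
simplicial⇔ skeleton-mid Γ v = mk⇔ id id
simplicial⇔ skeleton-weakly Γ v = mk⇔ id id
simplicial⇔ skeleton-very-weakly Γ v = mk⇔
  (λ (v∈ , s) → v∈ , λ f g f∈ g∈ f≢g eq v∈f v∈g adj → s f g f∈ g∈ f≢g eq adj v∈f v∈g)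
  (λ (v∈ , s) → v∈ , λ f g f∈ g∈ f≢g eq adj v∈f v∈g → s f g f∈ g∈ f≢g eq v∈f v∈g adj)
simplicial⇔ skeleton-clique Γ v = mk⇔ id id

module _ (Δ : SimplicialComplex n) {W f g : Subset n} (f⊆W : f ⊆ W) (g⊆W : g ⊆ W) where

  private
    ∪⊆W : f ∪ g ⊆ W
    ∪⊆W = [ f⊆W , g⊆W ]′ ∘ x∈p∪q⁻ f g

    ∪-m⊆W : (f ∪ g) - m ⊆ W
    ∪-m⊆W {m} = ∪⊆W ∘ p─q⊆p (f ∪ g) ⁅ m ⁆

  -- Every set claimed to be a face lies in `f ∪ g`, hence in `W`.
  Conclusion-induced : (P : Property) → Conclusion P Δ f g m → Conclusion P (induced Δ W) f g m
  Conclusion-induced skeleton-E c h h⊆ eq = c h h⊆ eq , λ x∈h → ∪⊆W (h⊆ x∈h)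
  Conclusion-induced skeleton-mid c e ∣e∣≡2 e⊆ =
    let e∈Δ , h , h∈Δ , eq , e⊆h , h⊆ = c e ∣e∣≡2 e⊆
    in  (e∈Δ , λ x∈e → ∪-m⊆W (e⊆ x∈e)) ,
        h , (h∈Δ , λ x∈h → ∪-m⊆W (h⊆ x∈h)) , eq , e⊆h , h⊆
  Conclusion-induced skeleton-weakly (h , h∈Δ , h⊆ , eq) =
    h , (h∈Δ , λ x∈h → ∪-m⊆W (h⊆ x∈h)) , h⊆ , eq
  Conclusion-induced skeleton-very-weakly c adj = c adj , ∪-m⊆W
  Conclusion-induced skeleton-clique c e ∣e∣≡2 e⊆ = c e ∣e∣≡2 e⊆ , λ x∈e → ∪⊆W (e⊆ x∈e)

-- The complex enters only through claims that certain sets are faces, and faces of `induced Δ W`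
-- are faces of `Δ`.
Conclusion-ambient : (P : Property) (Δ : SimplicialComplex n) →
                     Conclusion P (induced Δ W) f g m → Conclusion P Δ f g m
Conclusion-ambient skeleton-E Δ c h h⊆ eq = proj₁ (c h h⊆ eq)
Conclusion-ambient skeleton-mid Δ c e ∣e∣≡2 e⊆ =
  let (e∈Δ , _) , h , (h∈Δ , _) , rest = c e ∣e∣≡2 e⊆ in e∈Δ , h , h∈Δ , rest
Conclusion-ambient skeleton-weakly Δ (h , (h∈Δ , _) , rest) = h , h∈Δ , rest
Conclusion-ambient skeleton-very-weakly Δ c adj = proj₁ (c adj)
Conclusion-ambient skeleton-clique Δ c e ∣e∣≡2 e⊆ = proj₁ (c e ∣e∣≡2 e⊆)

-- The two directions of the equivalence.

face⊆vertices : (Δ : SimplicialComplex n) → Face Δ f → f ⊆ vertices Δ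
face⊆vertices Δ f∈Δ {x} x∈f =
  Equivalence.from (∈vertices⇔Face Δ x) (closed Δ (⁅x⁆⊆ x∈f) f∈Δ)

max-simplicial : (P : Property) (Δ : SimplicialComplex n) (L : Labeling Δ) →
  ChordalLabeling P Δ L → ∀ {i} → W ⊆ vertices Δ → IsMax Δ L W i →
  Simplicial P (induced Δ W) (vertexOf Δ L i)
max-simplicial {W = W} P Δ L chordal {i} W⊆ (v∈W , max) =
  Equivalence.from (simplicial⇔ P (induced Δ W) v)
    ( Equivalence.from (∈vertices⇔Face (induced Δ W) v)
        (Equivalence.to (∈vertices⇔Face Δ v) (W⊆ v∈W) , ⁅x⁆⊆ v∈W)
    , λ f g (f∈Δ , f⊆W) (g∈Δ , g⊆W) f≢g eq v∈f v∈g →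
        Conclusion-induced Δ f⊆W g⊆W P
          (chordal f g i f∈Δ g∈Δ f≢g eq
            -- The bound `i` on the labels in `W` holds in its subsets `f` and `g`, and both contain
            -- `v`, so `i` is the maximum of each.
            (v∈f , λ j → max j ∘ f⊆W) (v∈g , λ j → max j ∘ g⊆W)))
  where v = vertexOf Δ L i

simplicial⇒chordalLabeling : (P : Property) (Δ : SimplicialComplex n) →
  (∀ W → Nonempty W → W ⊆ vertices Δ → ∃ λ v → Simplicial P (induced Δ W) v) →
  Σ (Labeling Δ) (ChordalLabeling P Δ)
simplicial⇒chordalLabeling P Δ simplicial = L , λ f g i f∈Δ g∈Δ f≢g eq maxf maxg →
  let W , pairwise , below = initial i
      f⊆W = λ {x} → face⊆ below f∈Δ maxf {x}
      g⊆W = λ {x} → face⊆ below g∈Δ maxg {x}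
  in  Conclusion-ambient P Δ
        (pairwise f g (f∈Δ , f⊆W) (g∈Δ , g⊆W) f≢g eq (proj₁ maxf) (proj₁ maxg))
  where
  -- A simplicial vertex of `induced Δ W` is a vertex of that complex, so it lies in `W`, as
  -- elimination requires.
  pick : ∀ W → Nonempty W → W ⊆ vertices Δ →
         ∃ λ v → v ∈ W × PairwiseSimplicial P (induced Δ W) v
  pick W ne W⊆ =
    let v , s = simplicial W ne W⊆
        v∈ , pairwise = Equivalence.to (simplicial⇔ P (induced Δ W) v) s
        _ , ⁅v⁆⊆W = Equivalence.to (∈vertices⇔Face (induced Δ W) v) v∈
    in  v , ⁅v⁆⊆W (x∈⁅x⁆ v) , pairwise

  labeling = elimination⇒labeling Δ (eliminate (vertices Δ) pick refl)
  L        = proj₁ labeling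
  initial  = proj₂ labeling

  face⊆ : ∀ {W f i} → (∀ j → j ≤ᶠ i → vertexOf Δ L j ∈ W) → Face Δ f → IsMax Δ L f i → f ⊆ W
  -- Elements of a face are vertices and so have labels; these are at most the maximum `i`, which
  -- `below` places in `W`.
  face⊆ below f∈Δ (_ , max) x∈f with labelOf Δ L (face⊆vertices Δ f∈Δ x∈f)
  ... | j , refl = below j (max j x∈f)

theorem50 : ∀ {n : ℕ} (Δ : SimplicialComplex n) (P : Property) →
    Chordal P Δ ⇔
    (∀ (W : Subset n) → Nonempty W → W ⊆ vertices Δ →
    ∃ λ v → Simplicial P (induced Δ W) v)
theorem50 Δ P = mk⇔ to (Equivalence.from (chordal⇔ P Δ) ∘ simplicial⇒chordalLabeling P Δ)
  where
  to : Chordal P Δ → ∀ W → Nonempty W → W ⊆ vertices Δ → ∃ λ v → Simplicial P (induced Δ W) v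
  to chordal W ne W⊆ =
    let L , c  = Equivalence.to (chordal⇔ P Δ) chordal
        i , mi = ∃-IsMax Δ L ne W⊆
    in  vertexOf Δ L i , max-simplicial P Δ L c W⊆ mi
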